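{- Let $\mathcal{L}=\langle S, Act_\tau,\to\rangle$ be a finite-branching labelled transition system of processes, and let $\mathcal{T}=\langle T,Act_\tau\cup\{\omega\},\to\rangle$ be a labelled transition system of tests. Then every finitary test $t\in T$ is must-representable: there exists a (closed) formula $\phi\in\mathrm{recHML}$ such that for every $p\in S$, $p\ \mathbf{must\ satisfy}\ t$ if and only if $p\in[\![\phi]\!]$.
   Context: **Labelled transition systems.** An LTS over a set $Act$ of external actions is a triple $\langle S,Act_\tau,\to\rangle$ with $S$ a countable set of states (processes), $Act_\tau=Act\cup\{\tau\}$ a countable set of actions, where $\tau\notin Act$, and $\to\subseteq S\times Act_\tau\times S$; write $s\xrightarrow{\alpha}s'$ for $(s,\alpha,s')\in\to$, and $s\xrightarrow{\alpha}$ if such an $s'$ exists. The letter $a$ ranges over $Act$, $\alpha$ over $Act_\tau$. $\mathrm{Succ}(s)=\{s' : s\xrightarrow{\alpha}s'\text{ for some }\alpha\in Act_\tau\}$; an LTS is finite branching if $\mathrm{Succ}(s)$ is finite for every state $s$. $s\Uparrow$ (diverges) if there is an infinite path $s\xrightarrow{\tau}s_1\xrightarrow{\tau}\cdots$; otherwise $s\Downarrow$ (converges). Weak transitions: $\stackrel{\tau}{\Rightarrow}$ is the reflexive transitive closure of $\xrightarrow{\tau}$, and $s\stackrel{a}{\Rightarrow}s'$ means $s\stackrel{\tau}{\Rightarrow}s''\xrightarrow{a}s'''\stackrel{\tau}{\Rightarrow}s'$ for some $s'',s'''$; $s\stackrel{\alpha}{\Rightarrow}$ means $s\stackrel{\alpha}{\Rightarrow}s'$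 for some $s'$. **The language recHML.** It is the set of closed formulae generated by $\phi ::= \mathtt{tt}\mid\mathtt{ff}\mid X\mid \mathrm{Acc}\,A\mid\phi_1\vee\phi_2\mid\phi_1\wedge\phi_2\mid\langle\alpha\rangle\phi\mid[\alpha]\phi\mid\min(X,\phi)\mid\max(X,\phi)$, where $X$ ranges over a countable set $Var$ of variables, $\alpha\in Act_\tau$, $A$ is a finite subset of $Act$, and $\min(X,\cdot)$, $\max(X,\cdot)$ bind $X$. Given an environment $\rho:Var\to 2^S$: $[\![\mathtt{tt}]\!]\rho=S$; $[\![\mathtt{ff}]\!]\rho=\emptyset$; $[\![X]\!]\rho=\rho(X)$; $[\![\mathrm{Acc}\,A]\!]\rho=\{s : s\Downarrow,\text{ and } s\stackrel{\tau}{\Rightarrow}s'\text{ implies } s'\stackrel{a}{\Rightarrow}\text{ for some }a\in A\}$; $[\![\langle\alpha\rangle\phi]\!]\rho=\{s : s\stackrel{\alpha}{\Rightarrow}s'\text{ for some }s'\in[\![\phi]\!]\rho\}$; $[\![[\alpha]\phi]\!]\rho=\{s : s\Downarrow,\text{ and } s\stackrel{\alpha}{\Rightarrow}s'\text{ implies }s'\in[\![\phi]\!]\rho\}$; $\vee,\wedge$ are interpreted as union and intersection; $[\![\min(X,\phi)]\!]\rho=\bigcap\{P\subseteq S : [\![\phi]\!]\rho[X\mapsto P]\subseteq P\}$; $[\![\max(X,\phi)]\!]\rho=\bigcup\{P\subseteq S : P\subseteq[\![\phi]\!]\rho[X\mapsto P]\}$, where $\rho[X\mapsto P]$ is the environment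 that maps $X$ to $P$ and agrees with $\rho$ elsewhere. For closed $\phi$ the environment is omitted. **Tests.** A test is a state of an LTS $\mathcal{T}=\langle T,Act_\tau\cup\{\omega\},\to\rangle$, where $\omega\notin Act_\tau$ is a special success action. A test $t\in T$ is finitary if the derived LTS consisting of all states in $\mathcal{T}$ accessible from $t$ is finite. **Testing.** For a process $p$ and test $t$, the experiment $p\,|\,t$ has only $\tau$-moves: $p|t\to p'|t$ if $p\xrightarrow{\tau}p'$; $p|t\to p|t'$ if $t\xrightarrow{\tau}t'$; $p|t\to p'|t'$ if $p\xrightarrow{a}p'$ and $t\xrightarrow{a}t'$ for some $a\in Act$. A computation of $p|t$ is a maximal (finite or infinite) path $p|t\to p_1|t_1\to\cdots$ (with $p_0=p$, $t_0=t$); it is successful if $t_n\xrightarrow{\omega}$ for some $n\ge0$. $p\ \mathbf{must\ satisfy}\ t$ if every computation of $p|t$ is successful. -}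

module Defs where

open import Data.Empty.Polymorphic using (⊥)
open import Data.List.Base using (List)
open import Data.List.Membership.Propositional using (_∈_)
open import Data.Nat.Base using (ℕ; zero; suc)
open import Data.Nat.Properties using (_≟_)
open import Data.Product.Base using (Σ; ∃; ∃-syntax; _×_; _,_)
open import Data.Sum.Base using (_⊎_)
open import Data.Unit.Polymorphic using (⊤)
open import Function.Bundles using (_↣_; _⇔_)
open import Level using (0ℓ; Lift) renaming (suc to lsuc)
open import Relation.Binary.Core using (Rel)
open import Relation.Binary.Construct.Closure.ReflexiveTransitive using (Star)
open import Relation.Binary.PropositionalEquality.Core using (_≡_; _≢_)
open import Relation.Nullary using (¬_; yes; no)
open import Relation.Unary using (Pred; _⊆_; _∪_; _∩_)

Countable : Set → Set
Countable A = A ↣ ℕ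

Finite : {A : Set} → Pred A 0ℓ → Set
Finite {A} P = Σ (List A) λ xs → ∀ x → P x ⇔ (x ∈ xs)

record InfinitePath {A : Set} (R : Rel A 0ℓ) (x : A) : Set where
  field
    at    : ℕ → A
    start : at zero ≡ x
    next  : ∀ n → R (at n) (at (suc n))

-- Label Act is Act ∪ {τ}.
data Label (Act : Set) : Set where
  τ   : Label Act
  ext : Act → Label Act

record LTS (Act : Set) : Set₁ where
  field
    State           : Set
    _⟶[_]_          : State → Label Act → State → Set
    countableStates : Countable State
    countableLabels : Countable (Label Act)

  Succ : State → Pred State 0ℓ
  Succ s s′ = ∃[ α ] s ⟶[ α ] s′

  _⟶τ_ : Rel State 0ℓ
  s ⟶τ s′ = s ⟶[ τ ] s′

  _⇑ _⇓ : Pred State 0ℓ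
  s ⇑ = InfinitePath _⟶τ_ s
  s ⇓ = ¬ (s ⇑)

  _⟹[_]_ : State → Label Act → State → Set
  s ⟹[ τ ]     s′ = Star _⟶τ_ s s′
  s ⟹[ ext a ] s′ =
    ∃[ s₁ ] ∃[ s₂ ] Star _⟶τ_ s s₁ × s₁ ⟶[ ext a ] s₂ × Star _⟶τ_ s₂ s′

  FiniteBranching : Set
  FiniteBranching = ∀ s → Finite (Succ s)

  Accessible : State → Pred State 0ℓ
  Accessible = Star Succ

  -- Transitions of the LTS derived from s, as triples.
  DerivedTransition : State → Pred (State × Label Act × State) 0ℓ
  DerivedTransition s (s₁ , α , s₂) = Accessible s s₁ × s₁ ⟶[ α ] s₂

  -- The derived LTS is finite: finitely many states and finitely many
  -- transitions.  Since Act may be infinite, the first does not imply the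
  -- second.
  Finitary : Pred State 0ℓ
  Finitary s = Finite (Accessible s) × Finite (DerivedTransition s)

Var : Set
Var = ℕ

infix  9 ⟨_⟩_ [_]_
infixr 7 _∧_
infixr 6 _∨_

data Formula (Act : Set) : Set where
  tt ff   : Formula Act
  var     : Var → Formula Act
  -- The finite set A is given by a list of its elements.
  Acc     : List Act → Formula Act
  _∨_ _∧_ : Formula Act → Formula Act → Formula Act
  ⟨_⟩_    : Label Act → Formula Act → Formula Act
  [_]_    : Label Act → Formula Act → Formula Act
  min max : Var → Formula Act → Formula Act

module _ {Act : Set} where

  data _FreeIn_ (X : Var) : Formula Act → Set where
    var : X FreeIn var X
    ∨ˡ  : ∀ {φ ψ} → X FreeIn φ → X FreeIn (φ ∨ ψ)
    ∨ʳ  : ∀ {φ ψ} → X FreeIn ψ → X FreeIn (φ ∨ ψ)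
    ∧ˡ  : ∀ {φ ψ} → X FreeIn φ → X FreeIn (φ ∧ ψ)
    ∧ʳ  : ∀ {φ ψ} → X FreeIn ψ → X FreeIn (φ ∧ ψ)
    dia : ∀ {α φ} → X FreeIn φ → X FreeIn (⟨ α ⟩ φ)
    box : ∀ {α φ} → X FreeIn φ → X FreeIn ([ α ] φ)
    min : ∀ {Y φ} → X ≢ Y → X FreeIn φ → X FreeIn (min Y φ)
    max : ∀ {Y φ} → X ≢ Y → X FreeIn φ → X FreeIn (max Y φ)

  Closed : Formula Act → Set
  Closed φ = ∀ X → ¬ (X FreeIn φ)

module Semantics {Act : Set} (𝓛 : LTS Act) where
  open LTS 𝓛

  Env : Set₁
  Env = Var → Pred State 0ℓ

  _[_↦_] : Env → Var → Pred State 0ℓ → Env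
  (ρ [ X ↦ P ]) Y with Y ≟ X
  ... | yes _ = P
  ... | no  _ = ρ Y

  -- min and max quantify over all P : Pred State 0ℓ, so denotations live one
  -- universe up.  Excluded middle at that level identifies the two notions
  -- of subset.
  ⟦_⟧ : Formula Act → Env → Pred State (lsuc 0ℓ)
  ⟦ tt ⟧      ρ   = λ _ → ⊤
  ⟦ ff ⟧      ρ   = λ _ → ⊥
  ⟦ var X ⟧   ρ   = λ s → Lift _ (ρ X s)
  ⟦ Acc A ⟧   ρ   = λ s → Lift _
    (s ⇓ × (∀ s′ → s ⟹[ τ ] s′ → ∃[ a ] a ∈ A × ∃[ s″ ] s′ ⟹[ ext a ] s″))
  ⟦ φ ∨ ψ ⟧   ρ   = ⟦ φ ⟧ ρ ∪ ⟦ ψ ⟧ ρ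
  ⟦ φ ∧ ψ ⟧   ρ   = ⟦ φ ⟧ ρ ∩ ⟦ ψ ⟧ ρ
  ⟦ ⟨ α ⟩ φ ⟧ ρ   = λ s → ∃[ s′ ] s ⟹[ α ] s′ × ⟦ φ ⟧ ρ s′
  ⟦ [ α ] φ ⟧ ρ   = λ s → s ⇓ × (∀ s′ → s ⟹[ α ] s′ → ⟦ φ ⟧ ρ s′)
  ⟦ min X φ ⟧ ρ   = λ s →
    (P : Pred State 0ℓ) → ⟦ φ ⟧ (ρ [ X ↦ P ]) ⊆ P → P s
  ⟦ max X φ ⟧ ρ   = λ s →
    Σ (Pred State 0ℓ) λ P → P ⊆ ⟦ φ ⟧ (ρ [ X ↦ P ]) × P s

-- WithSuccess Act is Act ∪ {ω}, so tests are labelled by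
-- Label (WithSuccess Act).
data WithSuccess (Act : Set) : Set where
  act : Act → WithSuccess Act
  ω   : WithSuccess Act

module Testing {Act : Set} (𝓛 : LTS Act) (𝓣 : LTS (WithSuccess Act)) where
  private
    module L = LTS 𝓛
    module T = LTS 𝓣

  infix 5 _∣_
  infix 4 _⟶_

  data Experiment : Set where
    _∣_ : L.State → T.State → Experiment

  data _⟶_ : Rel Experiment 0ℓ where
    process : ∀ {p p′ t} → p L.⟶[ τ ] p′ → p ∣ t ⟶ p′ ∣ t
    test    : ∀ {p t t′} → t T.⟶[ τ ] t′ → p ∣ t ⟶ p ∣ t′
    sync    : ∀ {p p′ t t′} a → p L.⟶[ ext a ] p′ → t T.⟶[ ext (act a) ] t′ →
              p ∣ t ⟶ p′ ∣ t′

  Success : Pred Experiment 0ℓ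
  Success (p ∣ t) = ∃[ t′ ] t T.⟶[ ext ω ] t′

  data FinitePath (e : Experiment) : Set where
    stop : (∀ e′ → ¬ (e ⟶ e′)) → FinitePath e
    step : ∀ {e′} → e ⟶ e′ → FinitePath e′ → FinitePath e

  data Computation (e : Experiment) : Set where
    finite   : FinitePath e → Computation e
    infinite : InfinitePath _⟶_ e → Computation e

  -- Some experiment on the path, first and last included, is in Success.
  SuccessfulFinite : ∀ {e} → FinitePath e → Set
  SuccessfulFinite {e} (stop _)   = Success e
  SuccessfulFinite {e} (step _ c) = Success e ⊎ SuccessfulFinite c

  Successful : ∀ {e} → Computation e → Set
  Successful (finite c)   = SuccessfulFinite c
  Successful (infinite c) = ∃[ n ] Success (InfinitePath.at c n)

  _must-satisfy_ : L.State → T.State → Set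
  p must-satisfy t = (c : Computation (p ∣ t)) → Successful c

  -- For closed φ the environment is irrelevant, hence the quantification
  -- over all of them.
  MustRepresentable : T.State → Set₁
  MustRepresentable t =
    Σ (Formula Act) λ φ → Closed φ ×
      (∀ p (ρ : Semantics.Env 𝓛) → p must-satisfy t ⇔ Semantics.⟦_⟧ 𝓛 φ ρ p)

{-# OPTIONS --safe #-}

-- A process must satisfy a non-successful test t exactly when it satisfies
-- the conjunction of [ α ] "must satisfy t′" over the moves t -α→ t′, together
-- with Acc {a : t -a→} if t has no τ-move.  (If t has a τ-move, the
-- corresponding box already enforces convergence.)  The must-sets of the
-- accessible tests are the least solution of this finite equation system, and
-- Bekić's principle turns a least simultaneous solution into nested minimal
-- fixed points: the formula of an unknown i binds i by min and unfolds the
-- unknowns not yet bound.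
module Submission where

open import Defs
open import Axiom.ExcludedMiddle using (ExcludedMiddle)
open import Data.Empty using (⊥-elim)
open import Data.List.Base using (List; []; _∷_; filter; foldr; length; map)
open import Data.List.Membership.Propositional using (_∈_; _∉_)
open import Data.List.Membership.Propositional.Properties using (∈-filter⁺; ∈-filter⁻)
import Data.List.Membership.DecPropositional as DecMembership
open import Data.List.Properties using (filter-notAll)
open import Data.List.Relation.Unary.Any as Any using (here; there)
open import Data.Nat.Base using (ℕ; zero; suc; _≤_)
open import Data.Nat.Properties using (_≟_; eq?; ≤-refl; ≤-pred; ≤-trans)
open import Data.Product.Base using (Σ; ∃; ∃-syntax; _×_; _,_; proj₁; proj₂)
open import Data.Sum.Base using (inj₁; inj₂)
open import Function.Base using (_∘_; case_of_)
open import Function.Bundles using (Equivalence; Injection; _⇔_; _↣_; mk⇔)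
import Induction.WellFounded as WF
open import Level using (0ℓ; Lift; lift; lower) renaming (suc to lsuc)
open import Relation.Binary.Construct.Closure.ReflexiveTransitive using (Star; ε; _◅_; _◅◅_)
open import Relation.Binary.Core using (Rel)
open import Relation.Binary.Definitions using (DecidableEquality)
open import Relation.Binary.PropositionalEquality using (_≡_; _≢_; refl; sym; trans; cong; subst)
open import Relation.Nullary using (¬_; yes; no; contradiction)
open import Relation.Nullary.Decidable using (map′; ¬?; decidable-stable)
open import Relation.Unary using (Pred)

open Equivalence using (to; from)

-- Classical preliminaries: finite images, termination and infinite paths.

lowerEM : ExcludedMiddle (lsuc 0ℓ) → ExcludedMiddle 0ℓ
lowerEM em = map′ lower lift (em {Lift _ _})

module Classical (em : ExcludedMiddle 0ℓ) where

  -- Excluded middle decides whether an element has an image, and functionality makes the image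
  -- found the only one. This cuts the moves of a single test, and the actions it offers, out of the
  -- finite derived LTS.
  finite-image : {A B : Set} {P : Pred A 0ℓ} (R : A → B → Set) →
                 (∀ {x y z} → R x y → R x z → y ≡ z) →
                 Finite P → Finite (λ y → ∃[ x ] P x × R x y)
  finite-image {A} {B} R functional (xs , P⇔xs) = image xs , λ y → mk⇔
    (λ (x , px , r) → image⁺ xs (to (P⇔xs x) px) r)
    (λ y∈ → let x , x∈ , r = image⁻ xs y∈ in x , from (P⇔xs x) x∈ , r)
    where
    image : List A → List B
    image []       = []
    image (x ∷ xs) with em {∃ (R x)}
    ... | yes (y , _) = y ∷ image xs
    ... | no _        = image xs

    image⁺ : ∀ {x y} xs → x ∈ xs → R x y → y ∈ image xs
    image⁺ (x ∷ xs) x∈ r with em {∃ (R x)} | x∈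
    ... | yes (_ , r′) | here refl = here (functional r r′)
    ... | yes _        | there x∈′ = there (image⁺ xs x∈′ r)
    ... | no ¬r        | here refl = contradiction (_ , r) ¬r
    ... | no _         | there x∈′ = image⁺ xs x∈′ r

    image⁻ : ∀ {y} xs → y ∈ image xs → ∃[ x ] x ∈ xs × R x y
    image⁻ (x ∷ xs) y∈ with em {∃ (R x)}
    image⁻ (x ∷ xs) (here refl) | yes (_ , r) = x , here refl , r
    image⁻ (x ∷ xs) (there y∈)  | yes _ =
      let x′ , x′∈ , r = image⁻ xs y∈ in x′ , there x′∈ , r
    image⁻ (x ∷ xs) y∈          | no _ =
      let x′ , x′∈ , r = image⁻ xs y∈ in x′ , there x′∈ , r

  module _ {A : Set} {R : Rel A 0ℓ} where

    Terminating : Pred A 0ℓ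
    Terminating = WF.Acc (λ y x → R x y)

    nonterminating-step : ∀ {x} → ¬ Terminating x → ∃[ y ] R x y × ¬ Terminating y
    nonterminating-step ¬wf = decidable-stable em λ ¬step →
      ¬wf (WF.acc λ r → decidable-stable em λ ¬wf′ → ¬step (_ , r , ¬wf′))

    -- A nonterminating point has a nonterminating successor, given as an actual witness, so
    -- iterating from `x` yields an infinite path.
    ¬infinite⇒terminating : ∀ {x} → ¬ InfinitePath R x → Terminating x
    ¬infinite⇒terminating {x} ¬path = decidable-stable em λ ¬wf → ¬path (record
      { at    = proj₁ ∘ walk ¬wf
      ; start = refl
      ; next  = λ n → proj₁ (proj₂ (nonterminating-step (proj₂ (walk ¬wf n))))
      })
      where
      walk : ¬ Terminating x → ℕ → Σ A λ y → ¬ Terminating y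
      walk ¬wf zero    = x , ¬wf
      walk ¬wf (suc n) =
        let y , _ , ¬wf′ = nonterminating-step (proj₂ (walk ¬wf n)) in y , ¬wf′

prepend : {A : Set} {R : Rel A 0ℓ} {x y : A} → R x y → InfinitePath R y → InfinitePath R x
prepend {A} {R} {x} {y} r π = record
  { at    = at′
  ; start = refl
  ; next  = λ where
      zero    → subst (R x) (sym start) r
      (suc n) → next n
  }
  where
  open InfinitePath π
  at′ : ℕ → A
  at′ zero    = x
  at′ (suc n) = at n

-- Finite conjunctions and environment updates.

⋀ : {Act : Set} → List (Formula Act) → Formula Act
⋀ = foldr _∧_ tt

⋀-map-free : {Act B : Set} {X : Var} (f : B → Formula Act) (xs : List B) →
             X FreeIn ⋀ (map f xs) → ∃[ x ] x ∈ xs × X FreeIn f x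
⋀-map-free f (x ∷ xs) (∧ˡ free) = x , here refl , free
⋀-map-free f (x ∷ xs) (∧ʳ free) =
  let x′ , x′∈ , free′ = ⋀-map-free f xs free in x′ , there x′∈ , free′

module SemanticLemmas {Act : Set} (𝓛 : LTS Act) where
  open LTS 𝓛
  open Semantics 𝓛

  ⋀-map-intro : {B : Set} (f : B → Formula Act) (xs : List B) {ρ : Env} {p : State} →
                (∀ x → x ∈ xs → ⟦ f x ⟧ ρ p) → ⟦ ⋀ (map f xs) ⟧ ρ p
  ⋀-map-intro f []       h = _
  ⋀-map-intro f (x ∷ xs) h = h x (here refl) , ⋀-map-intro f xs (λ y → h y ∘ there)

  ⋀-map-elim : {B : Set} (f : B → Formula Act) (xs : List B) {ρ : Env} {p : State} →
               ⟦ ⋀ (map f xs) ⟧ ρ p → ∀ x → x ∈ xs → ⟦ f x ⟧ ρ p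
  ⋀-map-elim f (x ∷ xs) (h , _)  .x (here refl) = h
  ⋀-map-elim f (x ∷ xs) (_ , hs) y  (there y∈)  = ⋀-map-elim f xs hs y y∈

  update-same : ∀ (ρ : Env) X P {s} → P s ⇔ (ρ [ X ↦ P ]) X s
  update-same ρ X P with X ≟ X
  ... | yes _  = mk⇔ (λ z → z) (λ z → z)
  ... | no X≢X = contradiction refl X≢X

  update-other : ∀ (ρ : Env) {X Y} P {s} → Y ≢ X → ρ Y s ⇔ (ρ [ X ↦ P ]) Y s
  update-other ρ {X} {Y} P Y≢X with Y ≟ X
  ... | yes Y≡X = contradiction Y≡X Y≢X
  ... | no _    = mk⇔ (λ z → z) (λ z → z)

-- Least solutions of modal equation systems as nested minimal fixed points.

-- The system of equations i = base i ∧ ⋀ { [ α ] j : (α , j) ∈ boxes i }.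
module EquationSystem
  {Act : Set} (𝓛 : LTS Act) {I : Set} (name : I ↣ ℕ)
  (boxes : I → List (Label Act × I))
  (base : I → Formula Act) (Base : I → Pred (LTS.State 𝓛) 0ℓ)
  (base-closed : ∀ i → Closed (base i))
  (⟦base⟧ : ∀ i ρ p → Semantics.⟦_⟧ 𝓛 (base i) ρ p ⇔ Base i p)
  where

  open LTS 𝓛
  open Semantics 𝓛
  open SemanticLemmas 𝓛

  private
    X⟨_⟩ : I → Var
    X⟨_⟩ = Injection.to name

    _≟ᴵ_ : DecidableEquality I
    _≟ᴵ_ = eq? name

  open DecMembership _≟ᴵ_ using (_∈?_)

  infixl 6 _∖_

  _∖_ : List I → I → List I
  U ∖ i = filter (λ j → ¬? (j ≟ᴵ i)) U

  ∖⁺ : ∀ U {i j} → j ∈ U → j ≢ i → j ∈ U ∖ i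
  ∖⁺ U {i} = ∈-filter⁺ (λ j → ¬? (j ≟ᴵ i))

  ∖⁻ : ∀ U {i j} → j ∈ U ∖ i → j ∈ U × j ≢ i
  ∖⁻ U {i} = ∈-filter⁻ (λ j → ¬? (j ≟ᴵ i)) {xs = U}

  ∖-shorter : ∀ U {i n} → i ∈ U → length U ≤ suc n → length (U ∖ i) ≤ n
  ∖-shorter U {i} i∈U U≤ = ≤-pred (≤-trans
    (filter-notAll (λ j → ¬? (j ≟ᴵ i)) U (Any.map (λ eq ne → ne (sym eq)) i∈U)) U≤)

  -- The fuel n only serves termination: n ≥ length U suffices.
  formula : ℕ → List I → I → Formula Act
  formula zero    U i = var X⟨ i ⟩
  formula (suc n) U i with i ∈? U
  ... | no _  = var X⟨ i ⟩
  ... | yes _ = min X⟨ i ⟩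
                  (base i ∧ ⋀ (map (λ (α , j) → [ α ] formula n (U ∖ i) j) (boxes i)))

  -- The invariant `C` restricts attention to unknowns reachable through boxes; it is later taken to
  -- be accessibility, so that no variable remains free once `U` lists all accessible tests.
  formula-free : {C : Pred I 0ℓ} → (∀ i {α j} → (α , j) ∈ boxes i → C j) →
    ∀ n U i {X} → length U ≤ n → C i → X FreeIn formula n U i →
    ∃[ j ] C j × j ∉ U × X ≡ X⟨ j ⟩
  formula-free closed zero    [] i _  ci var = i , ci , (λ ()) , refl
  formula-free closed (suc n) U  i U≤ ci free with i ∈? U
  formula-free closed (suc n) U i U≤ ci var | no i∉U = i , ci , i∉U , refl
  formula-free closed (suc n) U i U≤ ci (min X≢ (∧ˡ free)) | yes _ =
    ⊥-elim (base-closed i _ free)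
  formula-free closed (suc n) U i U≤ ci (min X≢ (∧ʳ free)) | yes i∈U
    with ⋀-map-free _ (boxes i) free
  ... | (α , j) , j∈ , box free′ =
    let k , ck , k∉ , X≡ =
          formula-free closed n (U ∖ i) j (∖-shorter U i∈U U≤) (closed i j∈) free′
    -- The binder gives `X ≢ X⟨ i ⟩`, hence `k ≢ i`, so membership of `k` in `U` would survive the
    -- removal of `i`.
    in k , ck , (λ k∈U → k∉ (∖⁺ U k∈U (X≢ ∘ trans X≡ ∘ cong X⟨_⟩))) , X≡

  -- The least solution of the equations of the unknowns in U, the other
  -- unknowns being interpreted by ρ.
  data Solution (U : List I) (ρ : Env) (i : I) (p : State) : Set where
    free  : i ∉ U → ρ X⟨ i ⟩ p → Solution U ρ i p
    solve : i ∈ U → Base i p →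
            (∀ {α j} → (α , j) ∈ boxes i → p ⇓) →
            (∀ {α j p′} → (α , j) ∈ boxes i → p ⟹[ α ] p′ → Solution U ρ j p′) →
            Solution U ρ i p

  -- The two halves of Bekić's principle.
  solution-unbind : ∀ U ρ {i j p} → i ∈ U →
    Solution (U ∖ i) (ρ [ X⟨ i ⟩ ↦ Solution U ρ i ]) j p → Solution U ρ j p
  solution-unbind U ρ {i} {j} i∈U (free j∉ r) with j ≟ᴵ i
  -- The variable of `i` stands for `Solution U ρ i`, so reading it back returns the required
  -- derivation.
  ... | yes refl = from (update-same ρ X⟨ i ⟩ _) r
  ... | no j≢i   = free (λ j∈U → j∉ (∖⁺ U j∈U j≢i))
                        (from (update-other ρ _ (j≢i ∘ Injection.injective name)) r)
  solution-unbind U ρ i∈U (solve j∈ b c h) =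
    solve (proj₁ (∖⁻ U j∈)) b c (λ k∈ w → solution-unbind U ρ i∈U (h k∈ w))

  solution-bind : ∀ U ρ {i} P →
    (∀ {p} → Base i p → (∀ {α j} → (α , j) ∈ boxes i → p ⇓) →
      (∀ {α j p′} → (α , j) ∈ boxes i → p ⟹[ α ] p′ →
        Solution (U ∖ i) (ρ [ X⟨ i ⟩ ↦ P ]) j p′) → P p) →
    ∀ {j p} → i ∈ U → Solution U ρ j p → Solution (U ∖ i) (ρ [ X⟨ i ⟩ ↦ P ]) j p
  solution-bind U ρ {i} P pre {j} i∈U (free j∉U r) =
    free (j∉U ∘ proj₁ ∘ ∖⁻ U)
         (to (update-other ρ P λ eq →
           j∉U (subst (_∈ U) (sym (Injection.injective name eq)) i∈U)) r)
  solution-bind U ρ {i} P pre {j} i∈U (solve j∈U b c h) with j ≟ᴵ i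
  -- The premises are converted first; `pre` then puts the point into `P`, and the whole
  -- subderivation becomes a leaf for the bound variable.
  ... | yes refl = free (λ i∈ → proj₂ (∖⁻ U i∈) refl)
                        (to (update-same ρ X⟨ i ⟩ P)
                          (pre b c λ k∈ w → solution-bind U ρ P pre i∈U (h k∈ w)))
  ... | no j≢i   = solve (∖⁺ U j∈U j≢i) b c
                         (λ k∈ w → solution-bind U ρ P pre i∈U (h k∈ w))

  -- Induction on the fuel with `ρ` kept general, because the subformulas are evaluated in
  -- environments that reinterpret the variable of `i`.
  ⟦formula⟧ : ∀ n U → length U ≤ n → ∀ i ρ p → ⟦ formula n U i ⟧ ρ p ⇔ Solution U ρ i p
  ⟦formula⟧ zero [] _ i ρ p =
    mk⇔ (free (λ ()) ∘ lower) λ { (free _ r) → lift r ; (solve () _ _ _) }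
  ⟦formula⟧ (suc n) U U≤ i ρ p with i ∈? U
  ... | no i∉U = mk⇔ (free i∉U ∘ lower)
    λ { (free _ r) → lift r ; (solve i∈U _ _ _) → contradiction i∈U i∉U }
  ... | yes i∈U = mk⇔ sound complete
    where
    conjunct : Label Act × I → Formula Act
    conjunct (α , j) = [ α ] formula n (U ∖ i) j

    body : Formula Act
    body = base i ∧ ⋀ (map conjunct (boxes i))

    ih : ∀ j ρ p → ⟦ formula n (U ∖ i) j ⟧ ρ p ⇔ Solution (U ∖ i) ρ j p
    ih = ⟦formula⟧ n (U ∖ i) (∖-shorter U i∈U U≤)

    sound : ⟦ min X⟨ i ⟩ body ⟧ ρ p → Solution U ρ i p
    -- The least fixed point is contained in every pre-fixed point, and `Solution U ρ i` is one.
    sound h = h (Solution U ρ i) λ (b , bs) →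
      let boxed = ⋀-map-elim conjunct (boxes i) bs in
      solve i∈U (to (⟦base⟧ i _ _) b)
        (λ j∈ → proj₁ (boxed _ j∈))
        (λ j∈ w → solution-unbind U ρ i∈U (to (ih _ _ _) (proj₂ (boxed _ j∈) _ w)))

    complete : Solution U ρ i p → ⟦ min X⟨ i ⟩ body ⟧ ρ p
    complete s P body⊆P
      -- After binding, `i` is no longer among the unknowns to be solved, so only the leaf case is
      -- possible, and it says that `p` lies in `P`.
      with solution-bind U ρ P
             (λ b c h → body⊆P (from (⟦base⟧ i _ _) b ,
               ⋀-map-intro conjunct (boxes i) λ _ j∈ →
                 c j∈ , λ p′ w → from (ih _ _ _) (h j∈ w)))
             i∈U s
    ... | free _ r       = from (update-same ρ X⟨ i ⟩ P) r
    ... | solve i∈ _ _ _ = contradiction refl (proj₂ (∖⁻ U i∈))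

-- Must testing as an inductive predicate.

module MustTesting (em : ExcludedMiddle 0ℓ) {Act : Set}
  (𝓛 : LTS Act) (𝓣 : LTS (WithSuccess Act))
  (t₀ : LTS.State 𝓣) (finitary : LTS.Finitary 𝓣 t₀) where

  private
    module L = LTS 𝓛
    module T = LTS 𝓣
  open Testing 𝓛 𝓣
  open Classical em

  -- Well-foundedness excludes infinite unsuccessful computations; the move demanded by `later`
  -- excludes unsuccessful deadlocks.
  data Must (e : Experiment) : Set where
    now   : Success e → Must e
    later : ∃ (e ⟶_) → (∀ {e′} → e ⟶ e′ → Must e′) → Must e

  must⇒successful : ∀ {e} → Must e → (c : Computation e) → Successful c
  must⇒successful (now s) (finite (stop _))   = s
  must⇒successful (now s) (finite (step _ _)) = inj₁ s
  must⇒successful (now s) (infinite π)        =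
    0 , subst Success (sym (InfinitePath.start π)) s
  must⇒successful (later (_ , m) _) (finite (stop dead))  = contradiction m (dead _)
  must⇒successful (later _ h)       (finite (step m c))   =
    inj₂ (must⇒successful (h m) (finite c))
  must⇒successful {e} (later _ h)   (infinite π) =
    let n , s = must⇒successful (h first) (infinite tail) in suc n , s
    where
    open InfinitePath π
    first : e ⟶ at 1
    first = subst (_⟶ at 1) start (next 0)
    tail : InfinitePath _⟶_ (at 1)
    tail = record { at = at ∘ suc ; start = refl ; next = next ∘ suc }

  _⟶ᵘ_ : Rel Experiment 0ℓ
  e ⟶ᵘ e′ = ¬ Success e × e ⟶ e′

  -- An infinite `_⟶ᵘ_` path would be a computation that never succeeds. Hence this relation
  -- terminates at `e`, and `go` recurses along it.
  successful⇒must : ∀ {e} → ((c : Computation e) → Successful c) → Must e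
  successful⇒must {e} h = go h (¬infinite⇒terminating λ π →
    let open InfinitePath π
        n , s = h (infinite record { at = at ; start = start ; next = proj₂ ∘ next })
    in proj₁ (next n) s)
    where
    go : ∀ {e} → ((c : Computation e) → Successful c) → Terminating {R = _⟶ᵘ_} e → Must e
    go {e} h (WF.acc rs) with em {Success e} | em {∃ (e ⟶_)}
    ... | yes s | _     = now s
    ... | no ¬s | no ¬m = contradiction (h (finite (stop λ _ m → ¬m (_ , m)))) ¬s
    ... | no ¬s | yes m = later m λ r → go (continue r) (rs (¬s , r))
      where
      continue : ∀ {e′} → e ⟶ e′ → (c : Computation e′) → Successful c
      continue r (finite c) with h (finite (step r c))
      ... | inj₁ s = contradiction s ¬s
      ... | inj₂ s = s
      continue r (infinite π) with h (infinite (prepend r π))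
      ... | zero  , s = contradiction s ¬s
      ... | suc n , s = n , s

  -- Moves and offers of a test, and its equation.

  Successful-test : Pred T.State 0ℓ
  Successful-test t = ∃[ t′ ] t T.⟶[ ext ω ] t′

  Stable : Pred T.State 0ℓ
  Stable t = ∀ t′ → ¬ (t T.⟶[ τ ] t′)

  embed : Label Act → Label (WithSuccess Act)
  embed τ       = τ
  embed (ext a) = ext (act a)

  embed-injective : ∀ {α β} → embed α ≡ embed β → α ≡ β
  embed-injective {τ}     {τ}     _    = refl
  embed-injective {ext _} {ext _} refl = refl

  -- Accessibility keeps the moves within the finite derived LTS. A successful test gets no moves,
  -- so its equation reduces to `tt`.
  record IsMove (t : T.State) (m : Label Act × T.State) : Set where
    constructor move
    field
      accessible   : T.Accessible t₀ t
      unsuccessful : ¬ Successful-test t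
      transition   : t T.⟶[ embed (proj₁ m) ] proj₂ m

  finiteMoves : ∀ t → Finite (IsMove t)
  finiteMoves t =
    let ms , ms⇔ = finite-image R functional (proj₂ finitary) in
    ms , λ m → mk⇔
      (λ (move acc ¬s tr) → to (ms⇔ m) (_ , (acc , tr) , refl , ¬s))
      (λ m∈ → case from (ms⇔ m) m∈ of λ { (_ , (acc , tr) , refl , ¬s) → move acc ¬s tr })
    where
    R : T.State × Label (WithSuccess Act) × T.State → Label Act × T.State → Set
    R tr (α , t′) = tr ≡ (t , embed α , t′) × ¬ Successful-test t

    functional : ∀ {x y z} → R x y → R x z → y ≡ z
    functional {y = α , _} {z = β , _} (refl , _) (eq , _)
      with refl ← embed-injective {α} {β} (cong (proj₁ ∘ proj₂) eq)
      with refl ← cong (proj₂ ∘ proj₂) eq = refl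

  moves : T.State → List (Label Act × T.State)
  moves t = proj₁ (finiteMoves t)

  moves⁺ : ∀ {t m} → IsMove t m → m ∈ moves t
  moves⁺ {t} {m} = to (proj₂ (finiteMoves t) m)

  moves⁻ : ∀ {t m} → m ∈ moves t → IsMove t m
  moves⁻ {t} {m} = from (proj₂ (finiteMoves t) m)

  Offered : T.State → Pred Act 0ℓ
  Offered t a = ∃[ m ] IsMove t m × proj₁ m ≡ ext a

  finiteOffered : ∀ t → Finite (Offered t)
  finiteOffered t = finite-image (λ m a → proj₁ m ≡ ext a)
    (λ p q → case trans (sym p) q of λ { refl → refl }) (finiteMoves t)

  offers : T.State → List Act
  offers t = proj₁ (finiteOffered t)

  offers⁺ : ∀ {t a t′} → IsMove t (ext a , t′) → a ∈ offers t
  offers⁺ {t} m = to (proj₂ (finiteOffered t) _) (_ , m , refl)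

  offers⁻ : ∀ {t a} → a ∈ offers t → ∃[ t′ ] IsMove t (ext a , t′)
  offers⁻ {t} a∈ with from (proj₂ (finiteOffered t) _) a∈
  ... | (_ , t′) , m , refl = t′ , m

  Accepts : List Act → Pred L.State 0ℓ
  Accepts A p = (p L.⇓) ×
    (∀ p′ → p L.⟹[ τ ] p′ → ∃[ a ] a ∈ A × ∃[ p″ ] p′ L.⟹[ ext a ] p″)

  Base : T.State → Pred L.State 0ℓ
  Base t p = ¬ Successful-test t → Stable t → Accepts (offers t) p

  base : T.State → Formula Act
  base t with em {¬ Successful-test t × Stable t}
  ... | yes _ = Acc (offers t)
  ... | no _  = tt

  base-closed : ∀ t → Closed (base t)
  base-closed t X free with em {¬ Successful-test t × Stable t}
  base-closed t X () | yes _
  base-closed t X () | no _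

  ⟦base⟧ : ∀ t ρ p → Semantics.⟦_⟧ 𝓛 (base t) ρ p ⇔ Base t p
  ⟦base⟧ t ρ p with em {¬ Successful-test t × Stable t}
  ... | yes (¬s , st) = mk⇔ (λ h _ _ → lower h) (λ h → lift (h ¬s st))
  ... | no ¬both      = mk⇔ (λ _ ¬s st → contradiction (¬s , st) ¬both) _

  open EquationSystem 𝓛 T.countableStates moves base Base base-closed ⟦base⟧

  -- The must-sets coincide with the least solution.

  tests : List T.State
  tests = proj₁ (proj₁ finitary)

  accessible⇔∈tests : ∀ t → T.Accessible t₀ t ⇔ t ∈ tests
  accessible⇔∈tests = proj₂ (proj₁ finitary)

  accessible-step : ∀ {t α t′} → T.Accessible t₀ t → t T.⟶[ α ] t′ → T.Accessible t₀ t′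
  accessible-step acc tr = acc ◅◅ ((_ , tr) ◅ ε)

  -- Process moves leave the unsuccessful test in place, so a divergence of `p` would be an infinite
  -- descent through `Must`.
  must⇒converges : ∀ {t p} → ¬ Successful-test t → Must (p ∣ t) → p L.⇓
  must⇒converges ¬s (now s)     _ = ¬s s
  must⇒converges ¬s (later _ h) π =
    must⇒converges ¬s (h (process (subst (L._⟶τ at 1) start (next 0))))
      record { at = at ∘ suc ; start = refl ; next = next ∘ suc }
    where open InfinitePath π

  must-τ* : ∀ {t p p′} → ¬ Successful-test t → Must (p ∣ t) → Star L._⟶τ_ p p′ → Must (p′ ∣ t)
  must-τ* ¬s m           ε        = m
  must-τ* ¬s (now s)     (_ ◅ _)  = contradiction s ¬s
  must-τ* ¬s (later _ h) (r ◅ rs) = must-τ* ¬s (h (process r)) rs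

  -- Follow the moves provided by `later`: a stable test cannot move alone, so they are process
  -- moves until, by well-foundedness, a synchronisation occurs.
  must⇒offers : ∀ {t p} → T.Accessible t₀ t → ¬ Successful-test t → Stable t →
                Must (p ∣ t) → ∃[ a ] a ∈ offers t × ∃[ p′ ] p L.⟹[ ext a ] p′
  must⇒offers acc ¬s st (now s) = contradiction s ¬s
  must⇒offers acc ¬s st (later (_ , process r) h) =
    let a , a∈ , p′ , p₁ , p₂ , w , r′ , w′ = must⇒offers acc ¬s st (h (process r))
    in a , a∈ , p′ , p₁ , p₂ , r ◅ w , r′ , w′
  must⇒offers acc ¬s st (later (_ , test tr) h) = contradiction tr (st _)
  must⇒offers acc ¬s st (later (_ , sync a r tr) h) =
    a , offers⁺ (move acc ¬s tr) , _ , _ , _ , ε , r , ε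

  module _ (ρ : Semantics.Env 𝓛) where

    mutual
      must⇒solution : ∀ {t p} → T.Accessible t₀ t → Must (p ∣ t) → Solution tests ρ t p
      must⇒solution acc m = solve (to (accessible⇔∈tests _) acc)
        (λ ¬s st → must⇒converges ¬s m ,
                   λ _ w → must⇒offers acc ¬s st (must-τ* ¬s m w))
        (λ m∈ → must⇒converges (IsMove.unsuccessful (moves⁻ m∈)) m)
        (λ m∈ w → must⇒box (moves⁻ m∈) m w)

      -- Merging the walk along τ-moves into the recursion keeps the descent on the `Must`
      -- derivation structural.
      must⇒solution-τ* : ∀ {t p p′} → T.Accessible t₀ t → Must (p ∣ t) →
                         Star L._⟶τ_ p p′ → Solution tests ρ t p′
      must⇒solution-τ* acc m           ε        = must⇒solution acc m
      must⇒solution-τ* acc (later _ h) (r ◅ rs) = must⇒solution-τ* acc (h (process r)) rs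
      -- Success depends on the test alone, so `s` serves every derivative of the process.
      must⇒solution-τ* acc (now s)     (r ◅ rs) = must⇒solution acc (now s)

      must⇒box : ∀ {t α t′ p p′} → IsMove t (α , t′) → Must (p ∣ t) →
                 p L.⟹[ α ] p′ → Solution tests ρ t′ p′
      must⇒box m (now s) _ = contradiction s (IsMove.unsuccessful m)
      -- The test moves first; the process makes its τ-moves against `t′`.
      must⇒box {α = τ} (move acc _ tr) (later _ h) w =
        must⇒solution-τ* (accessible-step acc tr) (h (test tr)) w
      must⇒box {α = ext a} (move acc _ tr) (later _ h) (_ , _ , ε , r , w) =
        must⇒solution-τ* (accessible-step acc tr) (h (sync a r tr)) w
      must⇒box {α = ext a} m (later _ h) (p₁ , p₂ , r₀ ◅ w₀ , r , w) =
        must⇒box m (h (process r₀)) (p₁ , p₂ , w₀ , r , w)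

    -- Two nested inductions: the outer one on the solution handles moves of the test, the inner one
    -- on termination of τ from `p` handles moves of the process alone. The path `w` from `p` to `q`
    -- lets the boxes known at `p` be used at `q`.
    solution⇒must : ∀ {t p} → T.Accessible t₀ t → Solution tests ρ t p → Must (p ∣ t)
    solution⇒must acc (free t∉ _) = contradiction (to (accessible⇔∈tests _) acc) t∉
    solution⇒must {t} {p} acc (solve _ b c h) with em {Successful-test t}
    ... | yes s = now s
    ... | no ¬s = go ε (¬infinite⇒terminating converges)
      where
      unstable : ¬ Stable t → ∃[ t′ ] t T.⟶[ τ ] t′
      unstable ¬st = decidable-stable em λ ¬∃ → ¬st λ _ tr → ¬∃ (_ , tr)

      converges : p L.⇓
      converges with em {Stable t}
      ... | yes st = proj₁ (b ¬s st)
      ... | no ¬st = c {α = τ} (moves⁺ (move acc ¬s (proj₂ (unstable ¬st))))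

      live : ∀ {q} → Star L._⟶τ_ p q → ∃ (q ∣ t ⟶_)
      live w with em {Stable t}
      ... | no ¬st = _ , test (proj₂ (unstable ¬st))
      ... | yes st with proj₂ (b ¬s st) _ w
      -- The weak `a`-move granted by `Acc` begins either with `a` itself, which synchronises, or
      -- with a τ-move of the process.
      ...   | a , a∈ , _ , _ , _ , ε , r , _ =
                _ , sync a r (IsMove.transition (proj₂ (offers⁻ a∈)))
      ...   | _ , _ , _ , _ , _ , r ◅ _ , _ , _ = _ , process r

      go : ∀ {q} → Star L._⟶τ_ p q → Terminating {R = L._⟶τ_} q → Must (q ∣ t)
      go w (WF.acc rs) = later (live w) λ where
        (process r)   → go (w ◅◅ (r ◅ ε)) (rs r)
        (test tr)     → solution⇒must (accessible-step acc tr)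
                          (h {α = τ} (moves⁺ (move acc ¬s tr)) w)
        (sync a r tr) → solution⇒must (accessible-step acc tr)
                          (h {α = ext a} (moves⁺ (move acc ¬s tr)) (_ , _ , w , r , ε))

  -- The representing formula.

  mustRepresentable : MustRepresentable t₀
  mustRepresentable = formula (length tests) tests t₀ ,
    -- A free variable would name an accessible test missing from `tests`.
    (λ X free → let t , acc , t∉ , _ = formula-free {C = T.Accessible t₀}
                      (λ _ m∈ → let move acc _ tr = moves⁻ m∈ in accessible-step acc tr)
                      (length tests) tests t₀ ≤-refl ε free
                in t∉ (to (accessible⇔∈tests t) acc)) ,
    λ p ρ → let ⟦φ⟧ = ⟦formula⟧ (length tests) tests ≤-refl t₀ ρ p in mk⇔
      (from ⟦φ⟧ ∘ must⇒solution ρ ε ∘ successful⇒must)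
      (must⇒successful ∘ solution⇒must ρ ε ∘ to ⟦φ⟧)

theorem4p18 : ExcludedMiddle (lsuc 0ℓ) →
    (Act : Set) (𝓛 : LTS Act) → LTS.FiniteBranching 𝓛 →
    (𝓣 : LTS (WithSuccess Act)) (t : LTS.State 𝓣) → LTS.Finitary 𝓣 t →
    Testing.MustRepresentable 𝓛 𝓣 t
theorem4p18 em Act 𝓛 _ 𝓣 t finitary =
  MustTesting.mustRepresentable (lowerEM em) 𝓛 𝓣 t finitary
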